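{- Let $n\ge 1$ and $0\le k\le n$ be integers. The number $F^n_{n-k}$ of maximal rook placements with exactly $n-k$ rooks on the triangular board $\Psi_{1,\ldots,1}$ of size $n$ is $$F_{n-k}^n = k!\sum_{i=k}^{n-k} S(i,k)\cdot S(n+1-i,k+1).$$
   Context: The triangular board $\Psi_{1,\ldots,1}$ of size $n$ is the set of squares $\{(i,j): 1\le i\le j\le n\}$, where $i$ is the column and $j$ is the row (row $j$ has length $j$). A rook placement is a set of squares, no two in the same row and no two in the same column; it is maximal if no further square of the board can be added to it so that it remains a rook placement. $S(m,r)$ is the Stirling number of the second kind, the number of partitions of an $m$-element set into $r$ nonempty blocks ($S(0,0)=1$). A sum whose lower limit exceeds its upper limit is $0$. -}

module Defs where

open import Data.List using (List; []; _∷_; _++_; map; concatMap; downFrom; upTo; filter; length)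
open import Data.List.Membership.Propositional using (_∈_; _∉_)
open import Data.List.Relation.Binary.Disjoint.Propositional using (Disjoint)
open import Data.List.Relation.Unary.All using (All; all?)
open import Data.List.Relation.Unary.AllPairs using (AllPairs; allPairs?)
open import Data.List.Relation.Unary.Any using (Any; any?)
open import Data.Nat using (ℕ; suc; _+_; _∸_; _≟_)
open import Data.Nat.ListAction using (sum)
open import Data.Product using (_×_; _,_; proj₁; proj₂)
open import Data.Product.Properties using (≡-dec)
open import Level using (Level)
open import Relation.Binary.PropositionalEquality using (_≡_; _≢_)
open import Relation.Nullary using (¬_; ¬?; _×-dec_; _→-dec_)
open import Relation.Unary using (Pred; Decidable)

import Data.List.Membership.DecPropositional as DecMembership
import Data.List.Properties as List
import Data.List.Relation.Binary.Disjoint.DecPropositional as DecDisjoint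

private
  variable
    a p : Level
    A : Set a

-- Finite sets are represented by lists without repetitions.  If xs has no
-- repetitions, then `sublists xs` contains every subset of xs exactly once,
-- written in the order of xs; so counting subsets is counting entries of
-- `sublists xs`, and the order chosen for xs is immaterial.

sublists : List A → List (List A)
sublists []       = [] ∷ []
sublists (x ∷ xs) = map (x ∷_) (sublists xs) ++ sublists xs

count : {P : Pred A p} → Decidable P → List A → ℕ
count P? xs = length (filter P? xs)

[1⋯_] : ℕ → List ℕ
[1⋯ n ] = map suc (downFrom n)

-- Sum of f i over a ≤ i ≤ b; it is 0 when a > b, since then suc b ∸ a = 0.

∑[_⋯_] : ℕ → ℕ → (ℕ → ℕ) → ℕ
∑[ a ⋯ b ] f = sum (map (λ d → f (a + d)) (upTo (suc b ∸ a)))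

-- (column , row)

Square : Set
Square = ℕ × ℕ

column row : Square → ℕ
column = proj₁
row    = proj₂

triangularBoard : ℕ → List Square
triangularBoard n = concatMap (λ j → map (λ i → (i , j)) [1⋯ j ]) [1⋯ n ]

NonAttacking : Square → Square → Set
NonAttacking s t = column s ≢ column t × row s ≢ row t

RookPlacement : List Square → Set
RookPlacement = AllPairs NonAttacking

MaximalRookPlacement : List Square → List Square → Set
MaximalRookPlacement board rooks =
  RookPlacement rooks ×
  All (λ s → s ∉ rooks → ¬ RookPlacement (s ∷ rooks)) board

rookPlacement? : Decidable RookPlacement
rookPlacement? = allPairs? λ s t →
  ¬? (column s ≟ column t) ×-dec ¬? (row s ≟ row t)

maximalRookPlacement? : ∀ board → Decidable (MaximalRookPlacement board)
maximalRookPlacement? board rooks =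
  rookPlacement? rooks ×-dec
  all? (λ s → ¬? (s ∈? rooks) →-dec ¬? (rookPlacement? (s ∷ rooks))) board
  where open DecMembership (≡-dec _≟_ _≟_) using (_∈?_)

F : ℕ → ℕ → ℕ
F n r = count
  (λ rooks → maximalRookPlacement? (triangularBoard n) rooks ×-dec (length rooks ≟ r))
  (sublists (triangularBoard n))

-- That the blocks are distinct subsets of xs is not part of this predicate:
-- it is applied only to members of `sublists (sublists xs)`.

IsPartition : List ℕ → List (List ℕ) → Set
IsPartition xs blocks =
  All (_≢ []) blocks ×
  AllPairs Disjoint blocks ×
  All (λ x → Any (x ∈_) blocks) xs

isPartition? : ∀ xs → Decidable (IsPartition xs)
isPartition? xs blocks =
  all? (λ b → ¬? (List.≡-dec _≟_ b [])) blocks ×-dec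
  allPairs? disjoint? blocks ×-dec
  all? (λ x → any? (x ∈?_) blocks) xs
  where
  open DecMembership _≟_ using (_∈?_)
  open DecDisjoint _≟_ using (disjoint?)

S : ℕ → ℕ → ℕ
S m r = count
  (λ blocks → isPartition? [1⋯ m ] blocks ×-dec (length blocks ≟ r))
  (sublists (sublists [1⋯ m ]))

{-# OPTIONS --safe #-}

-- The board is built row by row, the newest row being the longest.  For a
-- placement on the first n rows let f be the number of free columns (equal to
-- the number of free rows) and let m count the marked columns: the free
-- columns that meet a free row in a square of the board.  The placement is
-- maximal iff m = 0.  The numbers of ways to extend it by one row depend only
-- on (f , m), which gives a recursion for the numbers T(n,k,l) of placements
-- on n rows with (f , m) = (k , l); its solution is
--   l! T(n,k,l) = k! Σ_{i ≤ n} S(i,k) S(n+1−i, k−l+1),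
-- where i is the index of the last free row (i = 0 if there is none).

module Submission where

open import Defs
open import Data.Bool using (true; false; if_then_else_)
open import Data.Empty using (⊥-elim)
open import Data.List using (List; []; _∷_; _++_; map; filter; length; upTo)
open import Data.List.Membership.Propositional using (_∈_; _∉_; find; lose)
open import Data.List.Membership.Propositional.Properties
  using (∈-map⁺; ∈-map⁻; ∈-++⁺ˡ; ∈-++⁺ʳ; ∈-++⁻; ∈-filter⁺; ∈-filter⁻;
         ∈-upTo⁻; ∈-downFrom⁺; ∈-downFrom⁻)
open import Data.List.Properties
  using (map-++; map-∘; map-cong; length-map; upTo-∷ʳ;
         filter-++; filter-≐; filter-accept; filter-reject; length-filter)
open import Data.List.Relation.Binary.Disjoint.Propositional using (Disjoint)
open import Data.List.Relation.Unary.All as All using (All; []; _∷_; all?)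
import Data.List.Relation.Unary.All.Properties as All
open import Data.List.Relation.Unary.AllPairs as AllPairs using ([]; _∷_)
import Data.List.Relation.Unary.AllPairs.Properties as AllPairs
open import Data.List.Relation.Unary.Any as Any using (Any; here; there; any?)
open import Data.List.Relation.Unary.Unique.Propositional using (Unique)
open import Data.List.Relation.Unary.Unique.Propositional.Properties using (Unique[x∷xs]⇒x∉xs)
import Data.List.Relation.Unary.Unique.Propositional.Properties as Unique
open import Data.Nat using (ℕ; zero; suc; _+_; _*_; _∸_; _≤_; _<_; z≤n; s≤s; _≟_; _≤?_; _<?_; _!)
open import Data.Nat.ListAction using (sum)
open import Data.Nat.ListAction.Properties using (sum-++)
open import Data.Nat.Properties
  using (+-assoc; +-comm; +-identityʳ; +-suc; +-cancelˡ-≡; +-∸-assoc; *-assoc; *-comm; *-identityʳ;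
         *-zeroʳ; *-distribˡ-+; *-distribʳ-+; suc-injective; m≢1+n+m; 1+n≰n;
         ≤-refl; ≤-reflexive; ≤-trans; ≤-total; ≤-pred; <⇒≤; <⇒≱; ≮⇒≥; ≤∧≢⇒<; m≤n⇒m≤1+n; m≤m+n;
         m∸n≤m; m+n∸n≡m; m+n∸m≡n; m+[n∸m]≡n; m∸n+n≡m; m∸[m∸n]≡n; m≤n⇒m∸n≡0; ∸-monoʳ-≤)
open import Data.Nat.Tactic.RingSolver using (solve-∀)
open import Data.Product using (_×_; _,_; proj₁; proj₂)
open import Data.Sum using (inj₁; inj₂)
open import Function using (_∘_; mk⇔)
open import Level using (Level)
open import Relation.Binary.PropositionalEquality
  using (_≡_; _≢_; refl; sym; trans; cong; cong₂; ≢-sym; module ≡-Reasoning)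
open import Relation.Nullary using (Dec; yes; no; does; ¬_; ¬?; _×-dec_)
open import Relation.Nullary.Decidable using (does-⇔; dec-true; dec-false)
open import Relation.Unary using (Pred; Decidable)

import Data.List.Membership.DecPropositional as DecMembership
import Data.List.Relation.Binary.Disjoint.DecPropositional as DecDisjoint

open DecMembership _≟_ using (_∈?_)
open DecDisjoint _≟_ using (disjoint?)
open ≡-Reasoning

-- A maximal placement may restrict to a non-maximal one on fewer rows, so all placements have to be
-- followed. The formula for T can be read off from the last free row i. That row marks every free
-- column, and `stirling i k` placements on i rows end in this way with k free columns. Each later
-- row holds a rook and also brings a column, so f stays k. If u = k - m free columns are unmarked,
-- the rook takes one of the k - u marked columns, raising u by one, or one of the u + 1 unmarked
-- ones, keeping u. The weights u + 1 are those of the Stirling recurrence and produce S(n+1-i,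
-- u+1); the factors k - u multiply to k!/l!. The formal argument does not track i: it checks that
-- both sides obey the same recursion in n. Since `S` counts actual set partitions, it is identified
-- separately with the recursively defined `stirling`.

private
  variable
    a b p q : Level
    A : Set a
    B : Set b
    P : Set p
    Q : Set q

-- Indicators and sums over lists

𝟙 : Dec P → ℕ
𝟙 P? = if does P? then 1 else 0

𝟙-⇔ : (P? : Dec P) (Q? : Dec Q) → (P → Q) → (Q → P) → 𝟙 P? ≡ 𝟙 Q?
𝟙-⇔ P? Q? f g = cong (if_then 1 else 0) (does-⇔ (mk⇔ f g) P? Q?)

𝟙-true : (P? : Dec P) → P → 𝟙 P? ≡ 1
𝟙-true P? x = cong (if_then 1 else 0) (dec-true P? x)

𝟙-false : (P? : Dec P) → ¬ P → 𝟙 P? ≡ 0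
𝟙-false P? ¬x = cong (if_then 1 else 0) (dec-false P? ¬x)

𝟙-× : (P? : Dec P) (Q? : Dec Q) → 𝟙 (P? ×-dec Q?) ≡ 𝟙 P? * 𝟙 Q?
𝟙-× (no _)  _  = refl
𝟙-× (yes _) Q? = sym (+-identityʳ _)

𝟙-*-cong : (P? : Dec P) {m n : ℕ} → (P → m ≡ n) → 𝟙 P? * m ≡ 𝟙 P? * n
𝟙-*-cong (no _)  _ = refl
𝟙-*-cong (yes x) e = cong (_+ 0) (e x)

sumOver : List A → (A → ℕ) → ℕ
sumOver xs f = sum (map f xs)

sumOver-++ : ∀ (xs ys : List A) f → sumOver (xs ++ ys) f ≡ sumOver xs f + sumOver ys f
sumOver-++ xs ys f = trans (cong sum (map-++ f xs ys)) (sum-++ (map f xs) (map f ys))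

sumOver-map : ∀ (g : A → B) xs f → sumOver (map g xs) f ≡ sumOver xs (f ∘ g)
sumOver-map g xs f = cong sum (sym (map-∘ xs))

sumOver-cong-∈ : ∀ (xs : List A) {f g} → (∀ x → x ∈ xs → f x ≡ g x) → sumOver xs f ≡ sumOver xs g
sumOver-cong-∈ []       e = refl
sumOver-cong-∈ (x ∷ xs) e =
  cong₂ _+_ (e x (here refl)) (sumOver-cong-∈ xs λ y y∈xs → e y (there y∈xs))

sumOver-cong : ∀ (xs : List A) {f g} → (∀ x → f x ≡ g x) → sumOver xs f ≡ sumOver xs g
sumOver-cong xs e = cong sum (map-cong e xs)

sumOver-+ : ∀ (xs : List A) f g → sumOver xs (λ x → f x + g x) ≡ sumOver xs f + sumOver xs g
sumOver-+ []       f g = refl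
sumOver-+ (x ∷ xs) f g = begin
  f x + g x + sumOver xs (λ x → f x + g x)  ≡⟨ cong (f x + g x +_) (sumOver-+ xs f g) ⟩
  f x + g x + (sumOver xs f + sumOver xs g) ≡⟨ interchange (f x) (g x) _ _ ⟩
  f x + sumOver xs f + (g x + sumOver xs g) ∎
  where
  interchange : ∀ i j k l → i + j + (k + l) ≡ i + k + (j + l)
  interchange = solve-∀

sumOver-0 : ∀ (xs : List A) → sumOver xs (λ _ → 0) ≡ 0
sumOver-0 []       = refl
sumOver-0 (_ ∷ xs) = sumOver-0 xs

sumOver-*ˡ : ∀ c (xs : List A) f → sumOver xs (λ x → c * f x) ≡ c * sumOver xs f
sumOver-*ˡ c []       f = sym (*-zeroʳ c)
sumOver-*ˡ c (x ∷ xs) f =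
  trans (cong (c * f x +_) (sumOver-*ˡ c xs f)) (sym (*-distribˡ-+ c (f x) _))

sumOver-*ʳ : ∀ c (xs : List A) f → sumOver xs (λ x → f x * c) ≡ sumOver xs f * c
sumOver-*ʳ c xs f = trans (sumOver-cong xs λ x → *-comm (f x) c)
                          (trans (sumOver-*ˡ c xs f) (*-comm c _))

sumOver-swap : ∀ (xs : List A) (ys : List B) (f : A → B → ℕ) →
  sumOver xs (λ x → sumOver ys (f x)) ≡ sumOver ys (λ y → sumOver xs (λ x → f x y))
sumOver-swap []       ys f = sym (sumOver-0 ys)
sumOver-swap (x ∷ xs) ys f =
  trans (cong (sumOver ys (f x) +_) (sumOver-swap xs ys f)) (sym (sumOver-+ ys (f x) _))

sumOver-filter : ∀ {P : Pred A p} (P? : Decidable P) xs f →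
  sumOver (filter P? xs) f ≡ sumOver xs (λ x → 𝟙 (P? x) * f x)
sumOver-filter P? []       f = refl
sumOver-filter P? (x ∷ xs) f with does (P? x)
... | true  = cong₂ _+_ (sym (+-identityʳ (f x))) (sumOver-filter P? xs f)
... | false = sumOver-filter P? xs f

count-sumOver : ∀ {P : Pred A p} (P? : Decidable P) xs → count P? xs ≡ sumOver xs (𝟙 ∘ P?)
count-sumOver P? []       = refl
count-sumOver P? (x ∷ xs) with does (P? x)
... | true  = cong suc (count-sumOver P? xs)
... | false = count-sumOver P? xs

filter-cong-∈ : ∀ {P : Pred A p} {Q : Pred A q} (P? : Decidable P) (Q? : Decidable Q) xs →
  (∀ {x} → x ∈ xs → (P x → Q x) × (Q x → P x)) → filter P? xs ≡ filter Q? xs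
filter-cong-∈ P? Q? []       e = refl
filter-cong-∈ P? Q? (x ∷ xs) e with P? x | Q? x
... | yes _ | yes _ = cong (x ∷_) (filter-cong-∈ P? Q? xs (e ∘ there))
... | no _  | no _  = filter-cong-∈ P? Q? xs (e ∘ there)
... | yes y | no ¬z = ⊥-elim (¬z (proj₁ (e (here refl)) y))
... | no ¬y | yes z = ⊥-elim (¬y (proj₂ (e (here refl)) z))

-- Sublists

sublists-⊆ : ∀ (xs : List A) {ys} → ys ∈ sublists xs → All (_∈ xs) ys
sublists-⊆ []       (here refl) = []
sublists-⊆ (x ∷ xs) ys∈ with ∈-++⁻ (map (x ∷_) (sublists xs)) ys∈
... | inj₂ q = All.map there (sublists-⊆ xs q)
... | inj₁ q with ∈-map⁻ (x ∷_) q
...   | _ , r , refl = here refl ∷ All.map there (sublists-⊆ xs r)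

sublists-map : ∀ (f : A → B) xs → sublists (map f xs) ≡ map (map f) (sublists xs)
sublists-map f []       = refl
sublists-map f (x ∷ xs) rewrite sublists-map f xs = begin
  map (f x ∷_) (map (map f) (sublists xs)) ++ map (map f) (sublists xs)
    ≡⟨ cong (_++ _) (trans (sym (map-∘ (sublists xs))) (map-∘ (sublists xs))) ⟩
  map (map f) (map (x ∷_) (sublists xs)) ++ map (map f) (sublists xs)
    ≡⟨ map-++ (map f) (map (x ∷_) (sublists xs)) (sublists xs) ⟨
  map (map f) (map (x ∷_) (sublists xs) ++ sublists xs) ∎

sumOver-sublists-∷ : ∀ (x : A) xs f →
  sumOver (sublists (x ∷ xs)) f ≡ sumOver (sublists xs) (f ∘ (x ∷_)) + sumOver (sublists xs) f
sumOver-sublists-∷ x xs f =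
  trans (sumOver-++ (map (x ∷_) (sublists xs)) (sublists xs) f)
        (cong (_+ _) (sumOver-map (x ∷_) (sublists xs) f))

sumOver-sublists-++ : ∀ (xs ys : List A) f →
  sumOver (sublists (xs ++ ys)) f ≡
  sumOver (sublists xs) (λ as → sumOver (sublists ys) (λ bs → f (as ++ bs)))
sumOver-sublists-++ []       ys f = sym (+-identityʳ _)
sumOver-sublists-++ (x ∷ xs) ys f = begin
  sumOver (sublists (x ∷ (xs ++ ys))) f
    ≡⟨ sumOver-sublists-∷ x (xs ++ ys) f ⟩
  sumOver (sublists (xs ++ ys)) (f ∘ (x ∷_)) + sumOver (sublists (xs ++ ys)) f
    ≡⟨ cong₂ _+_ (sumOver-sublists-++ xs ys (f ∘ (x ∷_))) (sumOver-sublists-++ xs ys f) ⟩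
  _ ≡⟨ sumOver-sublists-∷ x xs (λ as → sumOver (sublists ys) (λ bs → f (as ++ bs))) ⟨
  _ ∎

-- Serves two counts in which pairs are excluded: two blocks of a partition cannot share an element,
-- and two rooks cannot share a row.
sumOver-sublists-≤1 : ∀ (xs : List A) f → (∀ x y zs → f (x ∷ y ∷ zs) ≡ 0) →
  sumOver (sublists xs) f ≡ f [] + sumOver xs (λ x → f (x ∷ []))
sumOver-sublists-≤1 []       f f≥2 = refl
sumOver-sublists-≤1 (x ∷ xs) f f≥2 = begin
  sumOver (sublists (x ∷ xs)) f
    ≡⟨ sumOver-sublists-∷ x xs f ⟩
  sumOver (sublists xs) (f ∘ (x ∷_)) + sumOver (sublists xs) f
    ≡⟨ cong₂ _+_ (sumOver-sublists-≤1 xs (f ∘ (x ∷_)) λ y z zs → f≥2 x y (z ∷ zs))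
                 (sumOver-sublists-≤1 xs f f≥2) ⟩
  f (x ∷ []) + sumOver xs (λ y → f (x ∷ y ∷ [])) + (f [] + sumOver xs (λ y → f (y ∷ [])))
    ≡⟨ cong (λ s → f (x ∷ []) + s + _)
         (trans (sumOver-cong xs λ y → f≥2 x y []) (sumOver-0 xs)) ⟩
  f (x ∷ []) + 0 + (f [] + sumOver xs (λ y → f (y ∷ [])))
    ≡⟨ shuffle (f (x ∷ [])) (f []) _ ⟩
  f [] + (f (x ∷ []) + sumOver xs (λ y → f (y ∷ []))) ∎
  where
  shuffle : ∀ i j k → i + 0 + (j + k) ≡ j + (i + k)
  shuffle = solve-∀

filter-all?-map-∷ : ∀ {Q : Pred A q} (Q? : Decidable Q) x (xss : List (List A)) → Q x →
  filter (all? Q?) (map (x ∷_) xss) ≡ map (x ∷_) (filter (all? Q?) xss)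
filter-all?-map-∷ Q? x []         qx = refl
filter-all?-map-∷ Q? x (xs ∷ xss) qx with Q? x
... | no ¬qx = ⊥-elim (¬qx qx)
... | yes _ with does (all? Q? xs)
...   | true  = cong ((x ∷ xs) ∷_) (filter-all?-map-∷ Q? x xss qx)
...   | false = filter-all?-map-∷ Q? x xss qx

filter-all?-map-∷-∅ : ∀ {Q : Pred A q} (Q? : Decidable Q) x (xss : List (List A)) → ¬ Q x →
  filter (all? Q?) (map (x ∷_) xss) ≡ []
filter-all?-map-∷-∅ Q? x []         ¬qx = refl
filter-all?-map-∷-∅ Q? x (xs ∷ xss) ¬qx with Q? x
... | no _   = filter-all?-map-∷-∅ Q? x xss ¬qx
... | yes qx = ⊥-elim (¬qx qx)

-- An equality of lists, order included, so that it can be applied at both levels of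
-- `sublists (sublists ys)`.
sublists-filter : ∀ {Q : Pred A q} (Q? : Decidable Q) xs →
  filter (all? Q?) (sublists xs) ≡ sublists (filter Q? xs)
sublists-filter Q? []       = refl
sublists-filter Q? (x ∷ xs) =
  trans (filter-++ (all? Q?) (map (x ∷_) (sublists xs)) (sublists xs)) (go (Q? x))
  where
  go : Dec _ → filter (all? Q?) (map (x ∷_) (sublists xs)) ++ filter (all? Q?) (sublists xs) ≡
       sublists (filter Q? (x ∷ xs))
  go (yes qx) = begin
    filter (all? Q?) (map (x ∷_) (sublists xs)) ++ filter (all? Q?) (sublists xs)
      ≡⟨ cong (_++ _) (filter-all?-map-∷ Q? x (sublists xs) qx) ⟩
    map (x ∷_) (filter (all? Q?) (sublists xs)) ++ filter (all? Q?) (sublists xs)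
      ≡⟨ cong (λ yss → map (x ∷_) yss ++ yss) (sublists-filter Q? xs) ⟩
    sublists (x ∷ filter Q? xs)
      ≡⟨ cong sublists (filter-accept Q? qx) ⟨
    sublists (filter Q? (x ∷ xs)) ∎
  go (no ¬qx) = begin
    filter (all? Q?) (map (x ∷_) (sublists xs)) ++ filter (all? Q?) (sublists xs)
      ≡⟨ cong (_++ _) (filter-all?-map-∷-∅ Q? x (sublists xs) ¬qx) ⟩
    filter (all? Q?) (sublists xs)
      ≡⟨ sublists-filter Q? xs ⟩
    sublists (filter Q? xs)
      ≡⟨ cong sublists (filter-reject Q? ¬qx) ⟨
    sublists (filter Q? (x ∷ xs)) ∎

-- Stirling numbers

stirling : ℕ → ℕ → ℕ
stirling zero    zero    = 1
stirling zero    (suc r) = 0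
stirling (suc m) zero    = 0
stirling (suc m) (suc r) = suc r * stirling m (suc r) + stirling m r

-- The sum of h(m − |T|) over all subsets T of an m-element set.
sumOverComplements : ℕ → (ℕ → ℕ) → ℕ
sumOverComplements zero    h = h 0
sumOverComplements (suc m) h = sumOverComplements m h + sumOverComplements m (h ∘ suc)

-- Shaped so that the recurrence for `stirling (suc i) (suc r)` fits the hypothesis by `refl`.
sumOverComplements-linear : ∀ m c {f g h : ℕ → ℕ} → (∀ i → h i ≡ c * f i + g i) →
  sumOverComplements m h ≡ c * sumOverComplements m f + sumOverComplements m g
sumOverComplements-linear zero    c e = e 0
sumOverComplements-linear (suc m) c {f} {g} e =
  trans (cong₂ _+_ (sumOverComplements-linear m c e) (sumOverComplements-linear m c (e ∘ suc)))
        (regroup c (sumOverComplements m f) _ _ _)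
  where
  regroup : ∀ c i j k l → c * i + j + (c * k + l) ≡ c * (i + k) + (j + l)
  regroup = solve-∀

sumOverComplements-0 : ∀ m → sumOverComplements m (λ _ → 0) ≡ 0
sumOverComplements-0 zero    = refl
sumOverComplements-0 (suc m) = cong₂ _+_ (sumOverComplements-0 m) (sumOverComplements-0 m)

-- Induction on m: an extra element lies in T or in its complement, and in the second case the
-- Stirling recurrence expands the summand. Grouping the subsets by size gives the classical Σ
-- C(m,j) S(j,r) = S(m+1,r+1).
stirling-binomial : ∀ m r → sumOverComplements m (λ i → stirling i r) ≡ stirling (suc m) (suc r)
stirling-binomial zero zero = refl
stirling-binomial zero (suc r) = sym (trans (+-identityʳ _) (*-zeroʳ r))
stirling-binomial (suc m) zero = begin
  sumOverComplements m (λ i → stirling i 0) + sumOverComplements m (λ _ → 0)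
    ≡⟨ cong₂ _+_ (stirling-binomial m 0) (sumOverComplements-0 m) ⟩
  stirling (suc m) 1 + 0
    ≡⟨ cong (_+ 0) (sym (+-identityʳ (stirling (suc m) 1))) ⟩
  stirling (suc (suc m)) 1 ∎
stirling-binomial (suc m) (suc r) = begin
  sumOverComplements m (λ i → stirling i (suc r)) +
  sumOverComplements m (λ i → stirling (suc i) (suc r))
    ≡⟨ cong₂ _+_ (stirling-binomial m (suc r))
         (trans (sumOverComplements-linear m (suc r) λ _ → refl)
                (cong₂ (λ x y → suc r * x + y) (stirling-binomial m (suc r)) (stirling-binomial m r))) ⟩
  stirling (suc m) (2 + r) + (suc r * stirling (suc m) (2 + r) + stirling (suc m) (suc r))
    ≡⟨ +-assoc (stirling (suc m) (2 + r)) _ _ ⟨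
  stirling (2 + m) (2 + r) ∎

-- Counting set partitions by the block of the first element

complement : List ℕ → List ℕ → List ℕ
complement xs ys = filter (λ x → ¬? (x ∈? ys)) xs

complement-∉ : ∀ {x} xs ys → x ∉ xs → complement xs (x ∷ ys) ≡ complement xs ys
complement-∉ xs ys x∉xs = filter-cong-∈ (λ z → ¬? (z ∈? (_ ∷ ys))) (λ z → ¬? (z ∈? ys)) xs
  λ z∈xs → (_∘ there) ,
           λ { z∉ys (here refl) → x∉xs z∈xs ; z∉ys (there z∈ys) → z∉ys z∈ys }

sumOver-complements : ∀ xs h → Unique xs →
  sumOver (sublists xs) (λ T → h (length (complement xs T))) ≡ sumOverComplements (length xs) h
sumOver-complements []       h _ = +-identityʳ (h 0)
sumOver-complements (x ∷ xs) h uniq@(_ ∷ uniq′) = begin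
  sumOver (sublists (x ∷ xs)) (λ T → h (length (complement (x ∷ xs) T)))
    ≡⟨ sumOver-sublists-∷ x xs _ ⟩
  sumOver (sublists xs) (λ T → h (length (complement (x ∷ xs) (x ∷ T)))) +
  sumOver (sublists xs) (λ T → h (length (complement (x ∷ xs) T)))
    ≡⟨ cong₂ _+_
         (sumOver-cong (sublists xs) λ T → cong (h ∘ length)
           (trans (filter-reject (λ y → ¬? (y ∈? (x ∷ T))) (λ x∉ → x∉ (here refl)))
                  (complement-∉ xs T x∉xs)))
         (sumOver-cong-∈ (sublists xs) λ T T∈ → cong (h ∘ length)
           (filter-accept (λ y → ¬? (y ∈? T)) (λ x∈T → x∉xs (All.lookup (sublists-⊆ xs T∈) x∈T)))) ⟩
  sumOver (sublists xs) (λ T → h (length (complement xs T))) +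
  sumOver (sublists xs) (λ T → h (suc (length (complement xs T))))
    ≡⟨ cong₂ _+_ (sumOver-complements xs h uniq′) (sumOver-complements xs (h ∘ suc) uniq′) ⟩
  sumOverComplements (length (x ∷ xs)) h ∎
  where x∉xs = Unique[x∷xs]⇒x∉xs uniq

-- `S` with an arbitrary ground set: removing a block from `[1⋯ m ]` need not leave an initial
-- interval.
numPartitions : List ℕ → ℕ → ℕ
numPartitions xs r =
  count (λ blocks → isPartition? xs blocks ×-dec (length blocks ≟ r)) (sublists (sublists xs))

module _ {x : ℕ} {ys : List ℕ} (x∉ys : x ∉ ys) where

  isPartition-∷⁻ : ∀ {T Bs} → IsPartition (x ∷ ys) ((x ∷ T) ∷ Bs) →
    All (Disjoint T) Bs × IsPartition (complement ys T) Bs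
  isPartition-∷⁻ {T} {Bs} (_ ∷ ne , dj ∷ djs , _ ∷ cover) =
    All.map (λ d {_} (v∈T , v∈B) → d (there v∈T , v∈B)) dj , ne , djs , All.tabulate covered
    where
    covered : ∀ {y} → y ∈ complement ys T → Any (y ∈_) Bs
    covered y∈ with ∈-filter⁻ (λ y → ¬? (y ∈? T)) y∈
    ... | y∈ys , y∉T with All.lookup cover y∈ys
    ...   | here (here refl) = ⊥-elim (x∉ys y∈ys)
    ...   | here (there y∈T) = ⊥-elim (y∉T y∈T)
    ...   | there y∈Bs       = y∈Bs

  -- The blocks in Bs lie in ys and therefore avoid x; this upgrades disjointness from T to
  -- disjointness from `x ∷ T`.
  isPartition-∷⁺ : ∀ {T Bs} → All (All (_∈ ys)) Bs →
    All (Disjoint T) Bs → IsPartition (complement ys T) Bs → IsPartition (x ∷ ys) ((x ∷ T) ∷ Bs)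
  isPartition-∷⁺ {T} {Bs} Bs⊆ dj (ne , djs , cover) =
    (λ ()) ∷ ne , All.zipWith disjoint (dj , Bs⊆) ∷ djs , here (here refl) ∷ All.tabulate covered
    where
    disjoint : ∀ {U} → Disjoint T U × All (_∈ ys) U → Disjoint (x ∷ T) U
    disjoint (d , U⊆) (here refl , v∈U) = x∉ys (All.lookup U⊆ v∈U)
    disjoint (d , U⊆) (there v∈T , v∈U) = d (v∈T , v∈U)
    covered : ∀ {y} → y ∈ ys → Any (y ∈_) ((x ∷ T) ∷ Bs)
    covered {y} y∈ys with y ∈? T
    ... | yes y∈T = here (there y∈T)
    ... | no  y∉T = there (All.lookup cover (∈-filter⁺ (λ y → ¬? (y ∈? T)) y∈ys y∉T))

  -- In a partition of x ∷ ys the blocks containing x come first in the order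
  -- of sublists; there is exactly one, x ∷ T, and the others partition the
  -- complement of T in ys.
  numPartitions-∷ : ∀ r → numPartitions (x ∷ ys) (suc r) ≡
    sumOver (sublists ys) (λ T → numPartitions (complement ys T) r)
  numPartitions-∷ r = begin
    numPartitions (x ∷ ys) (suc r)
      ≡⟨ count-sumOver _ (sublists (sublists (x ∷ ys))) ⟩
    sumOver (sublists (map (x ∷_) zs ++ zs)) ind
      ≡⟨ sumOver-sublists-++ (map (x ∷_) zs) zs ind ⟩
    sumOver (sublists (map (x ∷_) zs)) (λ As → sumOver (sublists zs) (λ Bs → ind (As ++ Bs)))
      ≡⟨ cong (λ l → sumOver l (λ As → sumOver (sublists zs) (λ Bs → ind (As ++ Bs))))
           (sublists-map (x ∷_) zs) ⟩
    sumOver (map (map (x ∷_)) (sublists zs)) (λ As → sumOver (sublists zs) (λ Bs → ind (As ++ Bs)))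
      ≡⟨ sumOver-map (map (x ∷_)) (sublists zs) _ ⟩
    sumOver (sublists zs) withFirst
      ≡⟨ sumOver-sublists-≤1 zs withFirst ≥2 ⟩
    withFirst [] + sumOver zs (λ T → withFirst (T ∷ []))
      ≡⟨ cong₂ _+_ none (sumOver-cong zs one) ⟩
    sumOver zs (λ T → numPartitions (complement ys T) r) ∎
    where
    zs = sublists ys
    whole? : Decidable (λ blocks → IsPartition (x ∷ ys) blocks × length blocks ≡ suc r)
    whole? blocks = isPartition? (x ∷ ys) blocks ×-dec (length blocks ≟ suc r)
    ind : List (List ℕ) → ℕ
    ind = 𝟙 ∘ whole?
    withFirst : List (List ℕ) → ℕ
    withFirst Ts = sumOver (sublists zs) (λ Bs → ind (map (x ∷_) Ts ++ Bs))

    ≥2 : ∀ T U Vs → withFirst (T ∷ U ∷ Vs) ≡ 0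
    ≥2 T U Vs = trans
      (sumOver-cong (sublists zs) λ Bs → 𝟙-false (whole? (map (x ∷_) (T ∷ U ∷ Vs) ++ Bs))
        λ { ((_ , (d ∷ _) ∷ _ , _) , _) → d (here refl , here refl) })
      (sumOver-0 (sublists zs))

    blocks⊆ys : ∀ {Bs} → Bs ∈ sublists zs → All (All (_∈ ys)) Bs
    blocks⊆ys Bs∈ = All.map (sublists-⊆ ys) (sublists-⊆ zs Bs∈)

    none : withFirst [] ≡ 0
    none = trans
      (sumOver-cong-∈ (sublists zs) λ Bs Bs∈ → 𝟙-false (whole? Bs)
        λ { ((_ , _ , x∈Bs ∷ _) , _) →
          x∉ys (All.lookupWith (λ U⊆ → All.lookup U⊆) (blocks⊆ys Bs∈) x∈Bs) })
      (sumOver-0 (sublists zs))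

    one : ∀ T → withFirst (T ∷ []) ≡ numPartitions (complement ys T) r
    one T = begin
      sumOver (sublists zs) (λ Bs → ind ((x ∷ T) ∷ Bs))
        ≡⟨ sumOver-cong-∈ (sublists zs) (λ Bs Bs∈ → trans
             (𝟙-⇔ (whole? ((x ∷ T) ∷ Bs)) (all? (disjoint? T) Bs ×-dec rest? Bs)
               (λ (part , len) → let dj , part′ = isPartition-∷⁻ part
                                 in dj , part′ , suc-injective len)
               (λ (dj , part′ , len) → isPartition-∷⁺ (blocks⊆ys Bs∈) dj part′ , cong suc len))
             (𝟙-× (all? (disjoint? T) Bs) (rest? Bs))) ⟩
      sumOver (sublists zs) (λ Bs → 𝟙 (all? (disjoint? T) Bs) * 𝟙 (rest? Bs))
        ≡⟨ sumOver-filter (all? (disjoint? T)) (sublists zs) (𝟙 ∘ rest?) ⟨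
      sumOver (filter (all? (disjoint? T)) (sublists zs)) (𝟙 ∘ rest?)
        -- A block is disjoint from T exactly when all its elements avoid T. Filtering lists of
        -- blocks thus reduces to filtering blocks, and then elements, which leaves the candidates
        -- for partitions of the complement.
        ≡⟨ cong (λ l → sumOver l (𝟙 ∘ rest?)) (begin
             filter (all? (disjoint? T)) (sublists zs)
               ≡⟨ sublists-filter (disjoint? T) zs ⟩
             sublists (filter (disjoint? T) zs)
               ≡⟨ cong sublists (filter-≐ (disjoint? T) (all? (λ y → ¬? (y ∈? T)))
                    ( (λ d → All.tabulate λ v∈U v∈T → d (v∈T , v∈U))
                    , (λ U∩T=∅ {_} (v∈T , v∈U) → All.lookup U∩T=∅ v∈U v∈T)) zs) ⟩
             sublists (filter (all? (λ y → ¬? (y ∈? T))) (sublists ys))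
               ≡⟨ cong sublists (sublists-filter (λ y → ¬? (y ∈? T)) ys) ⟩
             sublists (sublists (complement ys T)) ∎) ⟩
      sumOver (sublists (sublists (complement ys T))) (𝟙 ∘ rest?)
        ≡⟨ count-sumOver rest? (sublists (sublists (complement ys T))) ⟨
      numPartitions (complement ys T) r ∎
      where
      rest? : Decidable (λ Bs → IsPartition (complement ys T) Bs × length Bs ≡ r)
      rest? Bs = isPartition? (complement ys T) Bs ×-dec (length Bs ≟ r)

numPartitions-∷-0 : ∀ x ys → numPartitions (x ∷ ys) 0 ≡ 0
numPartitions-∷-0 x ys = trans (count-sumOver _ blockLists)
  (trans (sumOver-cong blockLists λ blocks →
           𝟙-false (isPartition? (x ∷ ys) blocks ×-dec (length blocks ≟ 0)) (noBlocks blocks))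
         (sumOver-0 blockLists))
  where
  blockLists = sublists (sublists (x ∷ ys))
  noBlocks : ∀ blocks → ¬ (IsPartition (x ∷ ys) blocks × length blocks ≡ 0)
  noBlocks [] ((_ , _ , () ∷ _) , _)

-- The recursion runs on the bound n, because `complement ys T` is not a structural part of
-- `x ∷ ys`, only no longer than ys.
numPartitions-stirling : ∀ n xs → length xs ≤ n → Unique xs →
  ∀ r → numPartitions xs r ≡ stirling (length xs) r
numPartitions-stirling n       []       _ _ zero    = refl
numPartitions-stirling n       []       _ _ (suc r) = refl
numPartitions-stirling (suc n) (x ∷ ys) _ _ zero    = numPartitions-∷-0 x ys
numPartitions-stirling (suc n) (x ∷ ys) (s≤s len) uniq@(_ ∷ uniq′) (suc r) = begin
  numPartitions (x ∷ ys) (suc r)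
    ≡⟨ numPartitions-∷ (Unique[x∷xs]⇒x∉xs uniq) r ⟩
  sumOver (sublists ys) (λ T → numPartitions (complement ys T) r)
    ≡⟨ sumOver-cong (sublists ys) (λ T → numPartitions-stirling n (complement ys T)
         (≤-trans (length-filter (λ y → ¬? (y ∈? T)) ys) len)
         (Unique.filter⁺ (λ y → ¬? (y ∈? T)) uniq′) r) ⟩
  sumOver (sublists ys) (λ T → stirling (length (complement ys T)) r)
    ≡⟨ sumOver-complements ys (λ i → stirling i r) uniq′ ⟩
  sumOverComplements (length ys) (λ i → stirling i r)
    ≡⟨ stirling-binomial (length ys) r ⟩
  stirling (suc (length ys)) (suc r) ∎

length-[1⋯] : ∀ n → length [1⋯ n ] ≡ n
length-[1⋯] zero    = refl
length-[1⋯] (suc n) = cong suc (length-[1⋯] n)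

unique-[1⋯] : ∀ n → Unique [1⋯ n ]
unique-[1⋯] n = Unique.map⁺ suc-injective (Unique.downFrom⁺ n)

S-stirling : ∀ m r → S m r ≡ stirling m r
S-stirling m r = trans (numPartitions-stirling _ [1⋯ m ] ≤-refl (unique-[1⋯] m) r)
                       (cong (λ l → stirling l r) (length-[1⋯] m))

-- The row-by-row recursion

-- A new row n + 1 also brings the new free column n + 1.  Left empty, the row
-- marks every free column.  Otherwise its rook takes one of the m marked
-- columns, or one of the f + 1 ∸ m unmarked ones (including the new one).
step : (ℕ → ℕ → ℕ) → ℕ → ℕ → ℕ
step g f m = g (suc f) (suc f) + (m * g f (m ∸ 1) + (suc f ∸ m) * g f m)

-- The total of g over the states of all placements on n rows, in adjoint form: adding a row
-- transforms the test function g instead of the distribution of states. Particular counts arise by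
-- taking indicators for g.
evolve : ℕ → (ℕ → ℕ → ℕ) → ℕ
evolve zero    g = g 0 0
evolve (suc n) g = evolve n (step g)

-- Agreement for m ≤ f is enough because all three successor states in `step` keep m ≤ f, starting
-- from (0 , 0). The bound makes the truncated `suc f ∸ m` a true difference.
evolve-cong : ∀ n {g h} → (∀ f m → m ≤ f → g f m ≡ h f m) → evolve n g ≡ evolve n h
evolve-cong zero    e = e 0 0 z≤n
evolve-cong (suc n) e = evolve-cong n λ f m m≤f →
  cong₂ _+_ (e (suc f) (suc f) ≤-refl)
    (cong₂ (λ x y → m * x + (suc f ∸ m) * y) (e f (m ∸ 1) (≤-trans (m∸n≤m m 1) m≤f)) (e f m m≤f))

evolve-0 : ∀ n {g} → (∀ f m → m ≤ f → g f m ≡ 0) → evolve n g ≡ 0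
evolve-0 zero    e = e 0 0 z≤n
evolve-0 (suc n) {g} e = evolve-0 n λ f m m≤f → begin
  g (suc f) (suc f) + (m * g f (m ∸ 1) + (suc f ∸ m) * g f m)
    ≡⟨ cong₂ _+_ (e (suc f) (suc f) ≤-refl)
         (cong₂ (λ x y → m * x + (suc f ∸ m) * y)
                (e f (m ∸ 1) (≤-trans (m∸n≤m m 1) m≤f)) (e f m m≤f)) ⟩
  m * 0 + (suc f ∸ m) * 0
    ≡⟨ cong₂ _+_ (*-zeroʳ m) (*-zeroʳ (suc f ∸ m)) ⟩
  0 ∎

evolve-+ : ∀ n g h → evolve n (λ f m → g f m + h f m) ≡ evolve n g + evolve n h
evolve-+ zero    g h = refl
evolve-+ (suc n) g h = trans (evolve-cong n λ f m _ → distrib (g (suc f) (suc f)) _ m _ _ (suc f ∸ m) _ _)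
                             (evolve-+ n (step g) (step h))
  where
  distrib : ∀ i j m k l p q r →
    i + j + (m * (k + l) + p * (q + r)) ≡ i + (m * k + p * q) + (j + (m * l + p * r))
  distrib = solve-∀

evolve-* : ∀ n c g → evolve n (λ f m → c * g f m) ≡ c * evolve n g
evolve-* zero    c g = refl
evolve-* (suc n) c g = trans (evolve-cong n λ f m _ → distrib c (g (suc f) (suc f)) m _ (suc f ∸ m) _)
                             (evolve-* n c (step g))
  where
  distrib : ∀ c i m k p q → c * i + (m * (c * k) + p * (c * q)) ≡ c * (i + (m * k + p * q))
  distrib = solve-∀

-- The number of all placements with k free columns, by sumPlacements-evolve.
numWithFree : ℕ → ℕ → ℕ
numWithFree n k = evolve n (λ f _ → 𝟙 (f ≟ k))

-- The marks drop out: marked and unmarked free columns together offer f + 1 ways to fill the new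
-- row, whatever m is. What remains is the Stirling recurrence with both indices shifted by one.
numWithFree-stirling : ∀ n k → numWithFree n k ≡ stirling (suc n) (suc k)
numWithFree-stirling zero zero    = refl
numWithFree-stirling zero (suc k) = sym (trans (+-identityʳ _) (*-zeroʳ k))
numWithFree-stirling (suc n) k = begin
  evolve n (step (λ f _ → 𝟙 (f ≟ k)))
    ≡⟨ evolve-cong n (λ f m m≤f → cong (𝟙 (suc f ≟ k) +_) (trans
         (sym (*-distribʳ-+ (𝟙 (f ≟ k)) m (suc f ∸ m)))
         (trans (cong (_* 𝟙 (f ≟ k)) (m+[n∸m]≡n (m≤n⇒m≤1+n m≤f))) (suc-f≡suc-k f)))) ⟩
  evolve n (λ f _ → 𝟙 (suc f ≟ k) + suc k * 𝟙 (f ≟ k))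
    ≡⟨ evolve-+ n _ _ ⟩
  evolve n (λ f _ → 𝟙 (suc f ≟ k)) + evolve n (λ f _ → suc k * 𝟙 (f ≟ k))
    ≡⟨ cong₂ _+_ (predecessor k)
         (trans (evolve-* n (suc k) _) (cong (suc k *_) (numWithFree-stirling n k))) ⟩
  stirling (suc n) k + suc k * stirling (suc n) (suc k)
    ≡⟨ +-comm (stirling (suc n) k) _ ⟩
  stirling (suc (suc n)) (suc k) ∎
  where
  suc-f≡suc-k : ∀ f → suc f * 𝟙 (f ≟ k) ≡ suc k * 𝟙 (f ≟ k)
  suc-f≡suc-k f = trans (*-comm (suc f) _)
    (trans (𝟙-*-cong (f ≟ k) (cong suc)) (*-comm (𝟙 (f ≟ k)) (suc k)))
  predecessor : ∀ k → evolve n (λ f _ → 𝟙 (suc f ≟ k)) ≡ stirling (suc n) k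
  predecessor zero    = evolve-0 n λ _ _ _ → refl
  predecessor (suc k) = numWithFree-stirling n k

-- T(n,k,l) of the header.
numWithState : ℕ → ℕ → ℕ → ℕ
numWithState n k l = evolve n (λ f m → 𝟙 (f ≟ k) * 𝟙 (m ≟ l))

-- The number of placements that reach the state (k , l) by leaving row n + 1 empty.
numNewlyFree : ℕ → ℕ → ℕ → ℕ
numNewlyFree n k l = evolve n (λ f _ → 𝟙 (suc f ≟ k) * 𝟙 (suc f ≟ l))

numNewlyFree-≢ : ∀ n {k l} → k ≢ l → numNewlyFree n k l ≡ 0
numNewlyFree-≢ n {k} {l} k≢l = evolve-0 n λ f m _ → trans
  (sym (𝟙-× (suc f ≟ k) (suc f ≟ l)))
  (𝟙-false (suc f ≟ k ×-dec suc f ≟ l) λ (p , q) → k≢l (trans (sym p) q))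

numNewlyFree-≡ : ∀ n k → numNewlyFree n k k ≡ stirling (suc n) k
numNewlyFree-≡ n zero    = evolve-0 n λ _ _ _ → refl
numNewlyFree-≡ n (suc k) = trans
  (evolve-cong n λ f m _ → trans
    (sym (𝟙-× (f ≟ k) (f ≟ k)))
    (𝟙-⇔ (f ≟ k ×-dec f ≟ k) (f ≟ k) proj₁ λ p → p , p))
  (numWithFree-stirling n k)

numWithState-< : ∀ n {k l} → k < l → numWithState n k l ≡ 0
numWithState-< n {k} {l} k<l = evolve-0 n λ f m m≤f → trans
  (sym (𝟙-× (f ≟ k) (m ≟ l)))
  (𝟙-false (f ≟ k ×-dec m ≟ l) λ { (refl , refl) → <⇒≱ k<l m≤f })

-- `step` read backwards: (k , l) is entered by an empty row, from (k , l + 1) through one of l + 1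
-- marked columns, or from (k , l) through one of k + 1 - l unmarked ones.
numWithState-suc : ∀ n k l → numWithState (suc n) k l ≡
  numNewlyFree n k l + (suc l * numWithState n k (suc l) + (suc k ∸ l) * numWithState n k l)
numWithState-suc n k l = begin
  evolve n (λ f m → 𝟙 (suc f ≟ k) * 𝟙 (suc f ≟ l) +
      (m * (𝟙 (f ≟ k) * 𝟙 (m ∸ 1 ≟ l)) + (suc f ∸ m) * (𝟙 (f ≟ k) * 𝟙 (m ≟ l))))
    ≡⟨ evolve-cong n (λ f m _ →
         cong (𝟙 (suc f ≟ k) * 𝟙 (suc f ≟ l) +_) (cong₂ _+_ (fillMarked f m) (fillOther f m))) ⟩
  evolve n (λ f m → 𝟙 (suc f ≟ k) * 𝟙 (suc f ≟ l) +
      (suc l * (𝟙 (f ≟ k) * 𝟙 (m ≟ suc l)) + (suc k ∸ l) * (𝟙 (f ≟ k) * 𝟙 (m ≟ l))))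
    ≡⟨ evolve-+ n _ _ ⟩
  numNewlyFree n k l + evolve n (λ f m →
      suc l * (𝟙 (f ≟ k) * 𝟙 (m ≟ suc l)) + (suc k ∸ l) * (𝟙 (f ≟ k) * 𝟙 (m ≟ l)))
    ≡⟨ cong (numNewlyFree n k l +_) (trans (evolve-+ n _ _)
         (cong₂ _+_ (evolve-* n (suc l) _) (evolve-* n (suc k ∸ l) _))) ⟩
  numNewlyFree n k l + (suc l * numWithState n k (suc l) + (suc k ∸ l) * numWithState n k l) ∎
  where
  swap : ∀ i j k → i * (j * k) ≡ j * (k * i)
  swap = solve-∀
  fillMarked : ∀ f m → m * (𝟙 (f ≟ k) * 𝟙 (m ∸ 1 ≟ l)) ≡ suc l * (𝟙 (f ≟ k) * 𝟙 (m ≟ suc l))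
  -- Here `0 ∸ 1` is 0 and could match l = 0, but the factor m = 0 removes that term; on the right,
  -- 0 is never `suc l`.
  fillMarked f zero    = sym (trans (cong (suc l *_) (*-zeroʳ (𝟙 (f ≟ k)))) (*-zeroʳ (suc l)))
  fillMarked f (suc m) = begin
    suc m * (𝟙 (f ≟ k) * 𝟙 (m ≟ l)) ≡⟨ swap (suc m) (𝟙 (f ≟ k)) _ ⟩
    𝟙 (f ≟ k) * (𝟙 (m ≟ l) * suc m) ≡⟨ cong (𝟙 (f ≟ k) *_) (𝟙-*-cong (m ≟ l) (cong suc)) ⟩
    𝟙 (f ≟ k) * (𝟙 (m ≟ l) * suc l) ≡⟨ swap (suc l) (𝟙 (f ≟ k)) _ ⟨
    suc l * (𝟙 (f ≟ k) * 𝟙 (m ≟ l)) ∎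
  fillOther : ∀ f m → (suc f ∸ m) * (𝟙 (f ≟ k) * 𝟙 (m ≟ l)) ≡ (suc k ∸ l) * (𝟙 (f ≟ k) * 𝟙 (m ≟ l))
  fillOther f m = begin
    (suc f ∸ m) * (𝟙 (f ≟ k) * 𝟙 (m ≟ l)) ≡⟨ swap (suc f ∸ m) (𝟙 (f ≟ k)) _ ⟩
    𝟙 (f ≟ k) * (𝟙 (m ≟ l) * (suc f ∸ m))
      ≡⟨ 𝟙-*-cong (f ≟ k) (λ { refl → 𝟙-*-cong (m ≟ l) (cong (suc f ∸_)) }) ⟩
    𝟙 (f ≟ k) * (𝟙 (m ≟ l) * (suc k ∸ l)) ≡⟨ swap (suc k ∸ l) (𝟙 (f ≟ k)) _ ⟨
    (suc k ∸ l) * (𝟙 (f ≟ k) * 𝟙 (m ≟ l)) ∎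

-- The Stirling convolution solves the recursion

sumOver-upTo-suc : ∀ n f → sumOver (upTo (suc n)) f ≡ sumOver (upTo n) f + f n
sumOver-upTo-suc n f = begin
  sumOver (upTo (suc n)) f         ≡⟨ cong (λ l → sumOver l f) (upTo-∷ʳ n) ⟨
  sumOver (upTo n ++ n ∷ []) f     ≡⟨ sumOver-++ (upTo n) (n ∷ []) f ⟩
  sumOver (upTo n) f + (f n + 0)   ≡⟨ cong (sumOver (upTo n) f +_) (+-identityʳ (f n)) ⟩
  sumOver (upTo n) f + f n         ∎

-- The index u stands for k - l, the number of free columns without a mark; keeping it as a
-- parameter avoids truncated subtraction.
convolution : ℕ → ℕ → ℕ → ℕ
convolution n k u = sumOver (upTo (suc n)) (λ i → stirling i k * stirling (suc n ∸ i) (suc u))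

-- The Stirling recurrence is applied to the second factor for i ≤ n, and the new index i = n + 1 is
-- split off. For u = 0 the middle sum vanishes, for u > 0 the last term does.
convolution-suc : ∀ n k u → convolution (suc n) k u ≡
  suc u * convolution n k u +
  sumOver (upTo (suc n)) (λ i → stirling i k * stirling (suc n ∸ i) u) +
  stirling (suc n) k * stirling 1 (suc u)
convolution-suc n k u = begin
  sumOver (upTo (2 + n)) (λ i → stirling i k * stirling (2 + n ∸ i) (suc u))
    ≡⟨ sumOver-upTo-suc (suc n) (λ i → stirling i k * stirling (2 + n ∸ i) (suc u)) ⟩
  sumOver (upTo (suc n)) (λ i → stirling i k * stirling (2 + n ∸ i) (suc u)) +
  stirling (suc n) k * stirling (suc n ∸ n) (suc u)
    ≡⟨ cong₂ _+_
         (sumOver-cong-∈ (upTo (suc n)) λ i i∈ → begin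
           stirling i k * stirling (2 + n ∸ i) (suc u)
             ≡⟨ cong (λ j → stirling i k * stirling j (suc u)) (+-∸-assoc 1 (<⇒≤ (∈-upTo⁻ i∈))) ⟩
           stirling i k * (suc u * stirling (suc n ∸ i) (suc u) + stirling (suc n ∸ i) u)
             ≡⟨ distrib (stirling i k) (suc u) _ _ ⟩
           suc u * (stirling i k * stirling (suc n ∸ i) (suc u)) + stirling i k * stirling (suc n ∸ i) u ∎)
         (cong (λ j → stirling (suc n) k * stirling j (suc u)) (m+n∸n≡m 1 n)) ⟩
  sumOver (upTo (suc n)) (λ i → suc u * (stirling i k * stirling (suc n ∸ i) (suc u)) +
                                stirling i k * stirling (suc n ∸ i) u) +
  stirling (suc n) k * stirling 1 (suc u)
    ≡⟨ cong (_+ stirling (suc n) k * stirling 1 (suc u))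
         (trans (sumOver-+ (upTo (suc n)) (λ i → suc u * f i) g)
                (cong (_+ sumOver (upTo (suc n)) g) (sumOver-*ˡ (suc u) (upTo (suc n)) f))) ⟩
  _ ∎
  where
  f g : ℕ → ℕ
  f i = stirling i k * stirling (suc n ∸ i) (suc u)
  g i = stirling i k * stirling (suc n ∸ i) u
  distrib : ∀ a b c d → a * (b * c + d) ≡ b * (a * c) + a * d
  distrib = solve-∀

convolution-suc-0 : ∀ n k → convolution (suc n) k 0 ≡ convolution n k 0 + stirling (suc n) k
convolution-suc-0 n k = begin
  convolution (suc n) k 0
    ≡⟨ convolution-suc n k 0 ⟩
  convolution n k 0 + 0 + sumOver (upTo (suc n)) (λ i → stirling i k * stirling (suc n ∸ i) 0) +
  stirling (suc n) k * 1
    ≡⟨ cong₂ (λ x y → convolution n k 0 + 0 + x + y)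
         (trans (sumOver-cong-∈ (upTo (suc n)) λ i i∈ → trans
                  (cong (λ j → stirling i k * stirling j 0) (+-∸-assoc 1 (≤-pred (∈-upTo⁻ i∈))))
                  (*-zeroʳ (stirling i k)))
                (sumOver-0 (upTo (suc n))))
         (*-identityʳ (stirling (suc n) k)) ⟩
  convolution n k 0 + 0 + 0 + stirling (suc n) k
    ≡⟨ cong (_+ stirling (suc n) k) (trans (+-identityʳ _) (+-identityʳ _)) ⟩
  convolution n k 0 + stirling (suc n) k ∎

convolution-suc-suc : ∀ n k u →
  convolution (suc n) k (suc u) ≡ (2 + u) * convolution n k (suc u) + convolution n k u
convolution-suc-suc n k u = begin
  convolution (suc n) k (suc u)
    ≡⟨ convolution-suc n k (suc u) ⟩
  (2 + u) * convolution n k (suc u) + convolution n k u + stirling (suc n) k * stirling 1 (2 + u)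
    ≡⟨ cong (λ x → (2 + u) * convolution n k (suc u) + convolution n k u + stirling (suc n) k * x)
         (trans (+-identityʳ _) (*-zeroʳ u)) ⟩
  (2 + u) * convolution n k (suc u) + convolution n k u + stirling (suc n) k * 0
    ≡⟨ cong ((2 + u) * convolution n k (suc u) + convolution n k u +_) (*-zeroʳ (stirling (suc n) k)) ⟩
  (2 + u) * convolution n k (suc u) + convolution n k u + 0
    ≡⟨ +-identityʳ _ ⟩
  _ ∎

-- The factor l! absorbs the coefficient l + 1 of the recursion into (l + 1)!, which keeps
-- everything free of division. The case u = 0 is the diagonal k = l: only there does an empty row
-- contribute, and there the source (k , k + 1) is unreachable.
numWithState-convolution : ∀ n {k} u l → u + l ≡ k →
  l ! * numWithState n k l ≡ k ! * convolution n k u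
numWithState-convolution zero zero    zero    refl = refl
numWithState-convolution zero zero    (suc l) refl = refl
numWithState-convolution zero (suc u) l       refl = trans (*-zeroʳ (l !)) (sym (*-zeroʳ ((suc u + l) !)))
numWithState-convolution (suc n) zero l refl = begin
  l ! * numWithState (suc n) l l
    ≡⟨ cong (l ! *_) (numWithState-suc n l l) ⟩
  l ! * (numNewlyFree n l l + (suc l * numWithState n l (suc l) + (suc l ∸ l) * numWithState n l l))
    ≡⟨ cong (l ! *_) (cong₂ _+_ (numNewlyFree-≡ n l)
         (cong₂ (λ x y → suc l * x + y * numWithState n l l) (numWithState-< n ≤-refl) (m+n∸n≡m 1 l))) ⟩
  l ! * (stirling (suc n) l + (suc l * 0 + 1 * numWithState n l l))
    ≡⟨ regroup (l !) (stirling (suc n) l) (suc l) (numWithState n l l) ⟩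
  l ! * numWithState n l l + l ! * stirling (suc n) l
    ≡⟨ cong (_+ l ! * stirling (suc n) l) (numWithState-convolution n zero l refl) ⟩
  l ! * convolution n l 0 + l ! * stirling (suc n) l
    ≡⟨ *-distribˡ-+ (l !) _ _ ⟨
  l ! * (convolution n l 0 + stirling (suc n) l)
    ≡⟨ cong (l ! *_) (convolution-suc-0 n l) ⟨
  l ! * convolution (suc n) l 0 ∎
  where
  regroup : ∀ a b c d → a * (b + (c * 0 + 1 * d)) ≡ a * d + a * b
  regroup = solve-∀
numWithState-convolution (suc n) {k} (suc u) l e = begin
  l ! * numWithState (suc n) k l
    ≡⟨ cong (l ! *_) (numWithState-suc n k l) ⟩
  l ! * (numNewlyFree n k l + (suc l * numWithState n k (suc l) + (suc k ∸ l) * numWithState n k l))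
    ≡⟨ cong (l ! *_) (cong₂ (λ x y → x + (suc l * numWithState n k (suc l) + y * numWithState n k l))
         (numNewlyFree-≢ n λ k≡l → m≢1+n+m l (trans (sym k≡l) (sym e)))
         (trans (cong (λ x → suc x ∸ l) (sym e)) (m+n∸n≡m (2 + u) l))) ⟩
  l ! * (suc l * numWithState n k (suc l) + (2 + u) * numWithState n k l)
    ≡⟨ regroup (l !) (suc l) (numWithState n k (suc l)) (2 + u) (numWithState n k l) ⟩
  suc l ! * numWithState n k (suc l) + (2 + u) * (l ! * numWithState n k l)
    ≡⟨ cong₂ (λ x y → x + (2 + u) * y)
         (numWithState-convolution n u (suc l) (trans (+-suc u l) e))
         (numWithState-convolution n (suc u) l e) ⟩
  k ! * convolution n k u + (2 + u) * (k ! * convolution n k (suc u))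
    ≡⟨ collect (k !) _ (2 + u) _ ⟩
  k ! * ((2 + u) * convolution n k (suc u) + convolution n k u)
    ≡⟨ cong (k ! *_) (convolution-suc-suc n k u) ⟨
  k ! * convolution (suc n) k (suc u) ∎
  where
  regroup : ∀ a b c d e → a * (b * c + d * e) ≡ b * a * c + d * (a * e)
  regroup = solve-∀
  collect : ∀ a b c d → a * b + c * (a * d) ≡ a * (c * d + b)
  collect = solve-∀

-- Trimming the range of summation

stirling-< : ∀ {m r} → m < r → stirling m r ≡ 0
stirling-< {zero}  {suc r} _ = refl
stirling-< {suc m} {suc r} (s≤s m<r) =
  trans (cong₂ (λ x y → suc r * x + y) (stirling-< {m} (m≤n⇒m≤1+n m<r)) (stirling-< m<r))
        (trans (+-identityʳ _) (*-zeroʳ r))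

sumOver-upTo-+ : ∀ a b f →
  sumOver (upTo (a + b)) f ≡ sumOver (upTo a) f + sumOver (upTo b) (λ d → f (a + d))
sumOver-upTo-+ a zero f = trans (cong (λ x → sumOver (upTo x) f) (+-identityʳ a)) (sym (+-identityʳ _))
sumOver-upTo-+ a (suc b) f = begin
  sumOver (upTo (a + suc b)) f
    ≡⟨ cong (λ x → sumOver (upTo x) f) (+-suc a b) ⟩
  sumOver (upTo (suc (a + b))) f
    ≡⟨ sumOver-upTo-suc (a + b) f ⟩
  sumOver (upTo (a + b)) f + f (a + b)
    ≡⟨ cong (_+ f (a + b)) (sumOver-upTo-+ a b f) ⟩
  sumOver (upTo a) f + sumOver (upTo b) (λ d → f (a + d)) + f (a + b)
    ≡⟨ +-assoc (sumOver (upTo a) f) _ _ ⟩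
  sumOver (upTo a) f + (sumOver (upTo b) (λ d → f (a + d)) + f (a + b))
    ≡⟨ cong (sumOver (upTo a) f +_) (sumOver-upTo-suc b (λ d → f (a + d))) ⟨
  sumOver (upTo a) f + sumOver (upTo (suc b)) (λ d → f (a + d)) ∎

-- If the range a ⋯ b is empty, every i below n is still < a or > b.
sumOver-upTo-trim : ∀ n a b f → b < n → (∀ i → i < a → f i ≡ 0) → (∀ i → b < i → f i ≡ 0) →
  sumOver (upTo n) f ≡ ∑[ a ⋯ b ] f
sumOver-upTo-trim n a b f b<n f<a f>b with ≤-total a (suc b)
... | inj₁ a≤1+b = begin
  sumOver (upTo n) f
    ≡⟨ cong (λ x → sumOver (upTo x) f)
         (trans (sym (m+[n∸m]≡n b<n)) (cong (_+ (n ∸ suc b)) (sym (m+[n∸m]≡n a≤1+b)))) ⟩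
  sumOver (upTo (a + (suc b ∸ a) + (n ∸ suc b))) f
    ≡⟨ sumOver-upTo-+ (a + (suc b ∸ a)) (n ∸ suc b) f ⟩
  sumOver (upTo (a + (suc b ∸ a))) f + sumOver (upTo (n ∸ suc b)) (λ d → f (a + (suc b ∸ a) + d))
    ≡⟨ cong₂ _+_ (sumOver-upTo-+ a (suc b ∸ a) f)
         (trans (sumOver-cong (upTo (n ∸ suc b)) λ d → f>b _
                   (≤-trans (≤-reflexive (sym (m+[n∸m]≡n a≤1+b))) (m≤m+n _ d)))
                (sumOver-0 (upTo (n ∸ suc b)))) ⟩
  sumOver (upTo a) f + ∑[ a ⋯ b ] f + 0
    ≡⟨ +-identityʳ _ ⟩
  sumOver (upTo a) f + ∑[ a ⋯ b ] f
    ≡⟨ cong (_+ ∑[ a ⋯ b ] f)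
         (trans (sumOver-cong-∈ (upTo a) λ i i∈ → f<a i (∈-upTo⁻ i∈)) (sumOver-0 (upTo a))) ⟩
  ∑[ a ⋯ b ] f ∎
... | inj₂ 1+b≤a = begin
  sumOver (upTo n) f
    ≡⟨ trans (sumOver-cong (upTo n) f≡0) (sumOver-0 (upTo n)) ⟩
  0
    ≡⟨ cong (λ x → sumOver (upTo x) (λ d → f (a + d))) (m≤n⇒m∸n≡0 1+b≤a) ⟨
  ∑[ a ⋯ b ] f ∎
  where
  f≡0 : ∀ i → f i ≡ 0
  f≡0 i with i <? a
  ... | yes i<a = f<a i i<a
  ... | no  i≮a = f>b i (≤-trans 1+b≤a (≮⇒≥ i≮a))

-- The case l = 0, u = k. The range k ⋯ n ∸ k is the support of the summand: S(i,k) vanishes for i <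
-- k, and i > n - k makes n + 1 - i smaller than k + 1.
numWithState-0 : ∀ n k → k ≤ n → numWithState n k 0 ≡
  k ! * ∑[ k ⋯ n ∸ k ] (λ i → stirling i k * stirling (n + 1 ∸ i) (k + 1))
numWithState-0 n k k≤n = begin
  numWithState n k 0
    ≡⟨ +-identityʳ _ ⟨
  0 ! * numWithState n k 0
    ≡⟨ numWithState-convolution n k 0 (+-identityʳ k) ⟩
  k ! * sumOver (upTo (suc n)) (λ i → stirling i k * stirling (suc n ∸ i) (suc k))
    ≡⟨ cong (k ! *_) (sumOver-cong (upTo (suc n)) λ i →
         cong₂ (λ x y → stirling i k * stirling (x ∸ i) y) (+-comm 1 n) (+-comm 1 k)) ⟩
  k ! * sumOver (upTo (suc n)) term
    ≡⟨ cong (k ! *_) (sumOver-upTo-trim (suc n) k (n ∸ k) term (s≤s (m∸n≤m n k))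
         (λ i i<k → cong (_* stirling (n + 1 ∸ i) (k + 1)) (stirling-< i<k))
         (λ i n∸k<i → trans (cong (stirling i k *_) (stirling-< (short i n∸k<i))) (*-zeroʳ (stirling i k)))) ⟩
  k ! * ∑[ k ⋯ n ∸ k ] term ∎
  where
  term : ℕ → ℕ
  term i = stirling i k * stirling (n + 1 ∸ i) (k + 1)
  short : ∀ i → n ∸ k < i → n + 1 ∸ i < k + 1
  short i n∸k<i rewrite +-comm n 1 | +-comm k 1 =
    s≤s (≤-trans (∸-monoʳ-≤ (suc n) n∸k<i) (≤-reflexive (m∸[m∸n]≡n k≤n)))

-- Placements on the board

∈-[1⋯]⁻ : ∀ {n i} → i ∈ [1⋯ n ] → 1 ≤ i × i ≤ n
∈-[1⋯]⁻ i∈ with ∈-map⁻ suc i∈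
... | _ , j∈ , refl = s≤s z≤n , ∈-downFrom⁻ j∈

∈-[1⋯]⁺ : ∀ {n i} → 1 ≤ i → i ≤ n → i ∈ [1⋯ n ]
∈-[1⋯]⁺ {i = suc i} _ i<n = ∈-map⁺ suc (∈-downFrom⁺ i<n)

OnBoard : ℕ → Square → Set
OnBoard n s = 1 ≤ column s × column s ≤ row s × row s ≤ n

∈-triangularBoard⁻ : ∀ n {s} → s ∈ triangularBoard n → OnBoard n s
∈-triangularBoard⁻ (suc n) s∈ with ∈-++⁻ (map (_, suc n) [1⋯ suc n ]) s∈
... | inj₂ s∈′ = let 1≤i , i≤j , j≤n = ∈-triangularBoard⁻ n s∈′ in 1≤i , i≤j , m≤n⇒m≤1+n j≤n
... | inj₁ s∈′ with ∈-map⁻ (_, suc n) s∈′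
...   | _ , i∈ , refl = let 1≤i , i≤j = ∈-[1⋯]⁻ i∈ in 1≤i , i≤j , ≤-refl

∈-triangularBoard⁺ : ∀ n {s} → OnBoard n s → s ∈ triangularBoard n
∈-triangularBoard⁺ zero    (1≤i , i≤j , j≤0) = ⊥-elim (1+n≰n (≤-trans 1≤i (≤-trans i≤j j≤0)))
∈-triangularBoard⁺ (suc n) {i , j} (1≤i , i≤j , j≤1+n) with j ≟ suc n
... | yes refl = ∈-++⁺ˡ (∈-map⁺ (_, suc n) (∈-[1⋯]⁺ 1≤i i≤j))
... | no j≢1+n = ∈-++⁺ʳ (map (_, suc n) [1⋯ suc n ])
                   (∈-triangularBoard⁺ n (1≤i , i≤j , ≤-pred (≤∧≢⇒< j≤1+n j≢1+n)))

placement-onBoard : ∀ n {b} → b ∈ sublists (triangularBoard n) → All (OnBoard n) b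
placement-onBoard n b∈ = All.map (∈-triangularBoard⁻ n) (sublists-⊆ (triangularBoard n) b∈)

module _ {a b} {A : Set a} {B : Set b} {f : A → B} {x : B} where

  All-≢⇒∉-map : ∀ {xs} → All (λ y → x ≢ f y) xs → x ∉ map f xs
  All-≢⇒∉-map x≢ x∈ = All.All¬⇒¬Any (All.map⁺ x≢) x∈

  ∉-map⇒All-≢ : ∀ {xs} → x ∉ map f xs → All (λ y → x ≢ f y) xs
  ∉-map⇒All-≢ {xs} x∉ = All.map⁻ (All.¬Any⇒All¬ (map f xs) x∉)

rookPlacement-∷⁻ : ∀ {s b} → RookPlacement (s ∷ b) →
  column s ∉ map column b × row s ∉ map row b × RookPlacement b
rookPlacement-∷⁻ (na ∷ rp) = All-≢⇒∉-map (All.map proj₁ na) , All-≢⇒∉-map (All.map proj₂ na) , rp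

rookPlacement-∷⁺ : ∀ {s b} →
  column s ∉ map column b → row s ∉ map row b → RookPlacement b → RookPlacement (s ∷ b)
rookPlacement-∷⁺ c∉ r∉ rp = All.zip (∉-map⇒All-≢ c∉ , ∉-map⇒All-≢ r∉) ∷ rp

-- Free and marked columns of a placement

Free : List Square → ℕ → Set
Free b i = i ∉ map column b

free? : ∀ b → Decidable (Free b)
free? b i = ¬? (i ∈? map column b)

Marked : ℕ → List Square → ℕ → Set
Marked n b i = Free b i × Any (λ j → i ≤ j × j ∉ map row b) [1⋯ n ]

marked? : ∀ n b → Decidable (Marked n b)
marked? n b i = free? b i ×-dec any? (λ j → (i ≤? j) ×-dec ¬? (j ∈? map row b)) [1⋯ n ]

numFree : ℕ → List Square → ℕ
numFree n b = sumOver [1⋯ n ] (𝟙 ∘ free? b)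

numMarked : ℕ → List Square → ℕ
numMarked n b = sumOver [1⋯ n ] (𝟙 ∘ marked? n b)

sumOver-𝟙-⇔ : ∀ {P : Pred A p} {Q : Pred A q} (P? : Decidable P) (Q? : Decidable Q) xs →
  (∀ {x} → x ∈ xs → (P x → Q x) × (Q x → P x)) → sumOver xs (𝟙 ∘ P?) ≡ sumOver xs (𝟙 ∘ Q?)
sumOver-𝟙-⇔ P? Q? xs e = sumOver-cong-∈ xs λ x x∈ →
  𝟙-⇔ (P? x) (Q? x) (proj₁ (e x∈)) (proj₂ (e x∈))

-- The summand `𝟙 (P? x)` lets x satisfy P or not, so that a rook in a marked column and one in an
-- unmarked column are treated alike.
sumOver-𝟙-remove : ∀ {P : Pred A p} {Q : Pred A q} (P? : Decidable P) (Q? : Decidable Q) {xs x} →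
  Unique xs → x ∈ xs → (∀ {y} → (Q y → y ≢ x × P y) × (y ≢ x → P y → Q y)) →
  sumOver xs (𝟙 ∘ Q?) + 𝟙 (P? x) ≡ sumOver xs (𝟙 ∘ P?)
sumOver-𝟙-remove P? Q? {x ∷ xs} (x≢ ∷ _) (here refl) e = begin
  𝟙 (Q? x) + sumOver xs (𝟙 ∘ Q?) + 𝟙 (P? x)
    ≡⟨ cong₂ (λ u v → u + v + 𝟙 (P? x)) (𝟙-false (Q? x) λ qx → proj₁ (proj₁ e qx) refl)
         (sumOver-𝟙-⇔ Q? P? xs λ y∈ → (λ qy → proj₂ (proj₁ e qy)) , proj₂ e (≢-sym (All.lookup x≢ y∈))) ⟩
  sumOver xs (𝟙 ∘ P?) + 𝟙 (P? x)
    ≡⟨ +-comm (sumOver xs (𝟙 ∘ P?)) _ ⟩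
  𝟙 (P? x) + sumOver xs (𝟙 ∘ P?) ∎
sumOver-𝟙-remove P? Q? {z ∷ xs} {x} (z≢ ∷ uniq) (there x∈) e = begin
  𝟙 (Q? z) + sumOver xs (𝟙 ∘ Q?) + 𝟙 (P? x)
    ≡⟨ +-assoc (𝟙 (Q? z)) _ _ ⟩
  𝟙 (Q? z) + (sumOver xs (𝟙 ∘ Q?) + 𝟙 (P? x))
    ≡⟨ cong₂ _+_ (𝟙-⇔ (Q? z) (P? z) (λ qz → proj₂ (proj₁ e qz)) (proj₂ e (All.lookup z≢ x∈)))
         (sumOver-𝟙-remove P? Q? uniq x∈ e) ⟩
  𝟙 (P? z) + sumOver xs (𝟙 ∘ P?) ∎

𝟙-*-split : (P? : Dec P) (Q? : Dec Q) → (Q → P) → (h : ℕ → ℕ) →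
  𝟙 P? * h (𝟙 Q?) ≡ 𝟙 Q? * h 1 + 𝟙 (P? ×-dec ¬? Q?) * h 0
𝟙-*-split (yes _) (yes _) _   h = sym (+-identityʳ _)
𝟙-*-split (yes _) (no _)  _   h = refl
𝟙-*-split (no ¬p) (yes q) q⇒p h = ⊥-elim (¬p (q⇒p q))
𝟙-*-split (no _)  (no _)  _   h = refl

∉-∷ : ∀ {x y : A} {xs} → x ≢ y → x ∉ xs → x ∉ y ∷ xs
∉-∷ x≢y x∉ (here x≡y) = x≢y x≡y
∉-∷ x≢y x∉ (there x∈) = x∉ x∈

length+unused : ∀ {cs xs} → Unique xs → Unique cs → All (_∈ xs) cs →
  length cs + sumOver xs (λ x → 𝟙 (¬? (x ∈? cs))) ≡ length xs
length+unused {[]} {xs} _ _ _ = all-unused xs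
  where
  all-unused : ∀ (xs : List ℕ) → sumOver xs (λ _ → 1) ≡ length xs
  all-unused []       = refl
  all-unused (_ ∷ xs) = cong suc (all-unused xs)
length+unused {c ∷ cs} {xs} uniq (c≢ ∷ uniq′) (c∈ ∷ cs⊆) = begin
  suc (length cs) + sumOver xs (λ x → 𝟙 (¬? (x ∈? (c ∷ cs))))
    ≡⟨ shift (length cs) _ ⟩
  length cs + (sumOver xs (λ x → 𝟙 (¬? (x ∈? (c ∷ cs)))) + 1)
    ≡⟨ cong (λ u → length cs + (sumOver xs (λ x → 𝟙 (¬? (x ∈? (c ∷ cs)))) + u))
         (𝟙-true (¬? (c ∈? cs)) (All.All¬⇒¬Any c≢)) ⟨
  length cs + (sumOver xs (λ x → 𝟙 (¬? (x ∈? (c ∷ cs)))) + 𝟙 (¬? (c ∈? cs)))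
    ≡⟨ cong (length cs +_) (sumOver-𝟙-remove (λ x → ¬? (x ∈? cs)) (λ x → ¬? (x ∈? (c ∷ cs))) uniq c∈
         ((λ x∉ → x∉ ∘ here , x∉ ∘ there) , ∉-∷)) ⟩
  length cs + sumOver xs (λ x → 𝟙 (¬? (x ∈? cs)))
    ≡⟨ length+unused uniq uniq′ cs⊆ ⟩
  length xs ∎
  where
  shift : ∀ i j → suc i + j ≡ i + (j + 1)
  shift = solve-∀

-- The rooks occupy distinct columns among 1, ..., n. Hence the state determines the number of
-- rooks: n - k rooks mean k free columns.
length+numFree : ∀ n {b} → All (OnBoard n) b → RookPlacement b → length b + numFree n b ≡ n
length+numFree n {b} on rp = begin
  length b + numFree n b
    ≡⟨ cong (_+ numFree n b) (length-map column b) ⟨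
  length (map column b) + numFree n b
    ≡⟨ length+unused (unique-[1⋯] n) (AllPairs.map⁺ (AllPairs.map proj₁ rp))
         (All.map⁺ (All.map (λ (1≤i , i≤j , j≤n) → ∈-[1⋯]⁺ 1≤i (≤-trans i≤j j≤n)) on)) ⟩
  length [1⋯ n ]
    ≡⟨ length-[1⋯] n ⟩
  n ∎

module _ {n : ℕ} {b : List Square} (on : All (OnBoard n) b) where

  newRow∉ : suc n ∉ map row b
  newRow∉ = All-≢⇒∉-map (All.map (λ { (_ , _ , j≤n) refl → 1+n≰n j≤n }) on)

  newColumn-free : Free b (suc n)
  newColumn-free = All-≢⇒∉-map (All.map (λ { (_ , i≤j , j≤n) refl → 1+n≰n (≤-trans i≤j j≤n) }) on)

  newColumn-unmarked : ¬ Marked n b (suc n)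
  newColumn-unmarked (_ , j∈) with find j∈
  ... | _ , j∈ , n<j , _ = 1+n≰n (≤-trans n<j (proj₂ (∈-[1⋯]⁻ j∈)))

  numFree-suc : numFree (suc n) b ≡ suc (numFree n b)
  numFree-suc = cong (_+ numFree n b) (𝟙-true (free? b (suc n)) newColumn-free)

  numMarked-extend : sumOver [1⋯ suc n ] (𝟙 ∘ marked? n b) ≡ numMarked n b
  numMarked-extend = cong (_+ numMarked n b) (𝟙-false (marked? n b (suc n)) newColumn-unmarked)

  numMarked-suc : numMarked (suc n) b ≡ suc (numFree n b)
  numMarked-suc = trans
    (sumOver-𝟙-⇔ (marked? (suc n) b) (free? b) [1⋯ suc n ] λ i∈ →
      proj₁ , λ free → free , here (proj₂ (∈-[1⋯]⁻ i∈) , newRow∉))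
    numFree-suc

  module _ {i : ℕ} (i∈ : i ∈ [1⋯ suc n ]) (free : Free b i) where

    numFree-rook : numFree (suc n) ((i , suc n) ∷ b) ≡ numFree n b
    numFree-rook = suc-injective (begin
      suc (numFree (suc n) ((i , suc n) ∷ b))
        ≡⟨ +-comm 1 _ ⟩
      numFree (suc n) ((i , suc n) ∷ b) + 1
        ≡⟨ cong (numFree (suc n) ((i , suc n) ∷ b) +_) (𝟙-true (free? b i) free) ⟨
      numFree (suc n) ((i , suc n) ∷ b) + 𝟙 (free? b i)
        ≡⟨ sumOver-𝟙-remove (free? b) (free? ((i , suc n) ∷ b)) (unique-[1⋯] (suc n)) i∈
             ((λ x∉ → x∉ ∘ here , x∉ ∘ there) , ∉-∷) ⟩
      numFree (suc n) b
        ≡⟨ numFree-suc ⟩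
      suc (numFree n b) ∎)

    -- Row n + 1 is now occupied and marks nothing, so a mark must come from an older free row.
    marked-rook⁻ : ∀ {y} → Marked (suc n) ((i , suc n) ∷ b) y → y ≢ i × Marked n b y
    marked-rook⁻ (y∉ , here (_ , new∉)) = ⊥-elim (new∉ (here refl))
    marked-rook⁻ (y∉ , there j∈) = y∉ ∘ here , y∉ ∘ there , Any.map (λ (y≤j , j∉) → y≤j , j∉ ∘ there) j∈

    marked-rook⁺ : ∀ {y} → y ≢ i → Marked n b y → Marked (suc n) ((i , suc n) ∷ b) y
    marked-rook⁺ y≢i (y∉ , any) = ∉-∷ y≢i y∉ , there (lift any)
      where
      lift : Any (λ j → _ ≤ j × j ∉ map row b) [1⋯ n ] →
             Any (λ j → _ ≤ j × j ∉ map row ((i , suc n) ∷ b)) [1⋯ n ]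
      lift any with find any
      ... | j , j∈ , y≤j , j∉ =
        lose j∈ (y≤j , ∉-∷ (λ { refl → 1+n≰n (proj₂ (∈-[1⋯]⁻ j∈)) }) j∉)

    numMarked-rook : numMarked (suc n) ((i , suc n) ∷ b) ≡ numMarked n b ∸ 𝟙 (marked? n b i)
    numMarked-rook = begin
      numMarked (suc n) ((i , suc n) ∷ b)
        ≡⟨ m+n∸n≡m _ (𝟙 (marked? n b i)) ⟨
      numMarked (suc n) ((i , suc n) ∷ b) + 𝟙 (marked? n b i) ∸ 𝟙 (marked? n b i)
        ≡⟨ cong (_∸ 𝟙 (marked? n b i)) (trans
             (sumOver-𝟙-remove (marked? n b) (marked? (suc n) ((i , suc n) ∷ b)) (unique-[1⋯] (suc n)) i∈
               (marked-rook⁻ , marked-rook⁺))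
             numMarked-extend) ⟩
      numMarked n b ∸ 𝟙 (marked? n b i) ∎

  sumOver-newRook : ∀ (h : ℕ → ℕ) →
    sumOver [1⋯ suc n ] (λ i → 𝟙 (free? b i) * h (numMarked n b ∸ 𝟙 (marked? n b i))) ≡
    numMarked n b * h (numMarked n b ∸ 1) + (suc (numFree n b) ∸ numMarked n b) * h (numMarked n b)
  sumOver-newRook h = begin
    sumOver cols (λ i → 𝟙 (free? b i) * h (m ∸ 𝟙 (marked? n b i)))
      ≡⟨ splitSum (λ x → h (m ∸ x)) ⟩
    m * h (m ∸ 1) + unmarked * h m
      ≡⟨ cong (λ u → m * h (m ∸ 1) + u * h m) unmarked≡ ⟩
    m * h (m ∸ 1) + (suc (numFree n b) ∸ m) * h m ∎
    where
    cols = [1⋯ suc n ]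
    m = numMarked n b
    unmarked = sumOver cols (λ i → 𝟙 (free? b i ×-dec ¬? (marked? n b i)))

    splitSum : ∀ h → sumOver cols (λ i → 𝟙 (free? b i) * h (𝟙 (marked? n b i))) ≡
                     m * h 1 + unmarked * h 0
    splitSum h = begin
      sumOver cols (λ i → 𝟙 (free? b i) * h (𝟙 (marked? n b i)))
        ≡⟨ sumOver-cong cols (λ i → 𝟙-*-split (free? b i) (marked? n b i) proj₁ h) ⟩
      sumOver cols (λ i → 𝟙 (marked? n b i) * h 1 + 𝟙 (free? b i ×-dec ¬? (marked? n b i)) * h 0)
        ≡⟨ sumOver-+ cols (λ i → 𝟙 (marked? n b i) * h 1) _ ⟩
      sumOver cols (λ i → 𝟙 (marked? n b i) * h 1) +
      sumOver cols (λ i → 𝟙 (free? b i ×-dec ¬? (marked? n b i)) * h 0)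
        ≡⟨ cong₂ _+_
             (trans (sumOver-*ʳ (h 1) cols (𝟙 ∘ marked? n b)) (cong (_* h 1) numMarked-extend))
             (sumOver-*ʳ (h 0) cols (λ i → 𝟙 (free? b i ×-dec ¬? (marked? n b i)))) ⟩
      m * h 1 + unmarked * h 0 ∎

    unmarked≡ : unmarked ≡ suc (numFree n b) ∸ m
    unmarked≡ = begin
      unmarked
        ≡⟨ m+n∸m≡n m unmarked ⟨
      m + unmarked ∸ m
        ≡⟨ cong₂ (λ x y → x + y ∸ m) (*-identityʳ m) (*-identityʳ unmarked) ⟨
      m * 1 + unmarked * 1 ∸ m
        -- With the constant 1 as test function the split counts all free columns, including the new
        -- one, as m marked plus `unmarked` others.
        ≡⟨ cong (_∸ m) (splitSum (λ _ → 1)) ⟨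
      sumOver cols (λ i → 𝟙 (free? b i) * 1) ∸ m
        ≡⟨ cong (_∸ m) (sumOver-cong cols λ i → *-identityʳ _) ⟩
      numFree (suc n) b ∸ m
        ≡⟨ cong (_∸ m) numFree-suc ⟩
      suc (numFree n b) ∸ m ∎

-- Summing over all placements, one row at a time

weight : ℕ → (ℕ → ℕ → ℕ) → List Square → ℕ
weight n g b = 𝟙 (rookPlacement? b) * g (numFree n b) (numMarked n b)

sumPlacements : ℕ → (ℕ → ℕ → ℕ) → ℕ
sumPlacements n g = sumOver (sublists (triangularBoard n)) (weight n g)

weight-rook : ∀ {n b i} g → All (OnBoard n) b → i ∈ [1⋯ suc n ] →
  weight (suc n) g ((i , suc n) ∷ b) ≡
  𝟙 (rookPlacement? b) * (𝟙 (free? b i) * g (numFree n b) (numMarked n b ∸ 𝟙 (marked? n b i)))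
weight-rook {n} {b} {i} g on i∈ = begin
  𝟙 (rookPlacement? b⁺) * g (numFree (suc n) b⁺) (numMarked (suc n) b⁺)
    -- Under the indicator column i may be assumed free, as the formulas for the new counts require.
    ≡⟨ 𝟙-*-cong (rookPlacement? b⁺) (λ rp → let free , _ = rookPlacement-∷⁻ rp in
         cong₂ g (numFree-rook on i∈ free) (numMarked-rook on i∈ free)) ⟩
  𝟙 (rookPlacement? b⁺) * value
    ≡⟨ cong (_* value) (trans
         (𝟙-⇔ (rookPlacement? b⁺) (rookPlacement? b ×-dec free? b i)
           (λ rp → let free , _ , rp′ = rookPlacement-∷⁻ rp in rp′ , free)
           (λ (rp′ , free) → rookPlacement-∷⁺ free (newRow∉ on) rp′))
         (𝟙-× (rookPlacement? b) (free? b i))) ⟩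
  𝟙 (rookPlacement? b) * 𝟙 (free? b i) * value
    ≡⟨ *-assoc (𝟙 (rookPlacement? b)) _ _ ⟩
  𝟙 (rookPlacement? b) * (𝟙 (free? b i) * value) ∎
  where
  b⁺ = (i , suc n) ∷ b
  value = g (numFree n b) (numMarked n b ∸ 𝟙 (marked? n b i))

weight-newRow : ∀ {n b} g → All (OnBoard n) b →
  sumOver (sublists [1⋯ suc n ]) (λ is → weight (suc n) g (map (_, suc n) is ++ b)) ≡ weight n (step g) b
weight-newRow {n} {b} g on = begin
  sumOver (sublists cols) (λ is → weight (suc n) g (map (_, suc n) is ++ b))
    ≡⟨ sumOver-sublists-≤1 cols _ (λ i j is →
         cong (_* g (numFree (suc n) (map (_, suc n) (i ∷ j ∷ is) ++ b))
                    (numMarked (suc n) (map (_, suc n) (i ∷ j ∷ is) ++ b)))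
           (𝟙-false (rookPlacement? (map (_, suc n) (i ∷ j ∷ is) ++ b))
             λ { (((_ , r≢r) ∷ _) ∷ _) → r≢r refl })) ⟩
  weight (suc n) g b + sumOver cols (λ i → weight (suc n) g ((i , suc n) ∷ b))
    ≡⟨ cong₂ (λ x y → 𝟙 (rookPlacement? b) * x + y)
         (cong₂ g (numFree-suc on) (numMarked-suc on))
         (begin
           sumOver cols (λ i → weight (suc n) g ((i , suc n) ∷ b))
             ≡⟨ sumOver-cong-∈ cols (λ i i∈ → weight-rook g on i∈) ⟩
           sumOver cols (λ i → 𝟙 (rookPlacement? b) *
             (𝟙 (free? b i) * g f (m ∸ 𝟙 (marked? n b i))))
             ≡⟨ sumOver-*ˡ (𝟙 (rookPlacement? b)) cols _ ⟩
           𝟙 (rookPlacement? b) * sumOver cols (λ i → 𝟙 (free? b i) * g f (m ∸ 𝟙 (marked? n b i)))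
             ≡⟨ cong (𝟙 (rookPlacement? b) *_) (sumOver-newRook on (g f)) ⟩
           𝟙 (rookPlacement? b) * (m * g f (m ∸ 1) + (suc f ∸ m) * g f m) ∎) ⟩
  𝟙 (rookPlacement? b) * g (suc f) (suc f) +
  𝟙 (rookPlacement? b) * (m * g f (m ∸ 1) + (suc f ∸ m) * g f m)
    ≡⟨ *-distribˡ-+ (𝟙 (rookPlacement? b)) _ _ ⟨
  weight n (step g) b ∎
  where
  cols = [1⋯ suc n ]
  f = numFree n b
  m = numMarked n b

sumPlacements-evolve : ∀ n g → sumPlacements n g ≡ evolve n g
sumPlacements-evolve zero    g = trans (+-identityʳ _) (+-identityʳ (g 0 0))
sumPlacements-evolve (suc n) g = begin
  sumOver (sublists (map (_, suc n) cols ++ board)) (weight (suc n) g)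
    ≡⟨ sumOver-sublists-++ (map (_, suc n) cols) board (weight (suc n) g) ⟩
  sumOver (sublists (map (_, suc n) cols))
    (λ as → sumOver (sublists board) (λ b → weight (suc n) g (as ++ b)))
    ≡⟨ cong (λ l → sumOver l (λ as → sumOver (sublists board) (λ b → weight (suc n) g (as ++ b))))
         (sublists-map (_, suc n) cols) ⟩
  sumOver (map (map (_, suc n)) (sublists cols))
    (λ as → sumOver (sublists board) (λ b → weight (suc n) g (as ++ b)))
    ≡⟨ sumOver-map (map (_, suc n)) (sublists cols) _ ⟩
  sumOver (sublists cols)
    (λ is → sumOver (sublists board) (λ b → weight (suc n) g (map (_, suc n) is ++ b)))
    -- The board lists its newest row first; after the exchange the older rooks b are fixed while
    -- the new row varies, which is the sum that `step` describes.
    ≡⟨ sumOver-swap (sublists cols) (sublists board) (λ is b → weight (suc n) g (map (_, suc n) is ++ b)) ⟩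
  sumOver (sublists board)
    (λ b → sumOver (sublists cols) (λ is → weight (suc n) g (map (_, suc n) is ++ b)))
    ≡⟨ sumOver-cong-∈ (sublists board) (λ b b∈ → weight-newRow g (placement-onBoard n b∈)) ⟩
  sumPlacements n (step g)
    ≡⟨ sumPlacements-evolve n (step g) ⟩
  evolve n (step g) ∎
  where
  cols  = [1⋯ suc n ]
  board = triangularBoard n

-- Maximality as the absence of marks

sumOver-𝟙-≡0⁻ : ∀ {P : Pred A p} (P? : Decidable P) xs → sumOver xs (𝟙 ∘ P?) ≡ 0 → All (¬_ ∘ P) xs
sumOver-𝟙-≡0⁻ P? []       _ = []
sumOver-𝟙-≡0⁻ P? (x ∷ xs) e with P? x
... | no ¬px = ¬px ∷ sumOver-𝟙-≡0⁻ P? xs e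

sumOver-𝟙-≡0⁺ : ∀ {P : Pred A p} (P? : Decidable P) xs → All (¬_ ∘ P) xs → sumOver xs (𝟙 ∘ P?) ≡ 0
sumOver-𝟙-≡0⁺ P? []       _           = refl
sumOver-𝟙-≡0⁺ P? (x ∷ xs) (¬px ∷ ¬ps) = cong₂ _+_ (𝟙-false (P? x) ¬px) (sumOver-𝟙-≡0⁺ P? xs ¬ps)

-- A marked column meets a free row in a square of the board, and a rook there would enlarge the
-- placement.
maximal⇒unmarked : ∀ n {b} → MaximalRookPlacement (triangularBoard n) b → numMarked n b ≡ 0
maximal⇒unmarked n {b} (rp , maximal) = sumOver-𝟙-≡0⁺ (marked? n b) [1⋯ n ] (All.tabulate unmarked)
  where
  unmarked : ∀ {i} → i ∈ [1⋯ n ] → ¬ Marked n b i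
  unmarked {i} i∈ (free , any) with find any
  ... | j , j∈ , i≤j , j∉ =
    All.lookup maximal (∈-triangularBoard⁺ n (proj₁ (∈-[1⋯]⁻ i∈) , i≤j , proj₂ (∈-[1⋯]⁻ j∈)))
      (free ∘ ∈-map⁺ column) (rookPlacement-∷⁺ free j∉ rp)

unmarked⇒maximal : ∀ n {b} → RookPlacement b → numMarked n b ≡ 0 →
  MaximalRookPlacement (triangularBoard n) b
unmarked⇒maximal n {b} rp m≡0 = rp , All.tabulate λ s∈ _ rp⁺ →
  let 1≤i , i≤j , j≤n = ∈-triangularBoard⁻ n s∈
      free , j∉ , _   = rookPlacement-∷⁻ rp⁺
  in All.lookup (sumOver-𝟙-≡0⁻ (marked? n b) [1⋯ n ] m≡0) (∈-[1⋯]⁺ 1≤i (≤-trans i≤j j≤n))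
       (free , lose (∈-[1⋯]⁺ (≤-trans 1≤i i≤j) j≤n) (i≤j , j∉))

F-numWithState : ∀ n k → k ≤ n → F n (n ∸ k) ≡ numWithState n k 0
F-numWithState n k k≤n = begin
  F n (n ∸ k)
    ≡⟨ count-sumOver counted? (sublists (triangularBoard n)) ⟩
  sumOver (sublists (triangularBoard n)) (𝟙 ∘ counted?)
    ≡⟨ sumOver-cong-∈ (sublists (triangularBoard n)) (λ b b∈ → termwise b (placement-onBoard n b∈)) ⟩
  sumPlacements n (λ f m → 𝟙 (f ≟ k) * 𝟙 (m ≟ 0))
    ≡⟨ sumPlacements-evolve n _ ⟩
  numWithState n k 0 ∎
  where
  counted? : Decidable (λ b → MaximalRookPlacement (triangularBoard n) b × length b ≡ n ∸ k)
  counted? b = maximalRookPlacement? (triangularBoard n) b ×-dec (length b ≟ n ∸ k)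

  termwise : ∀ b → All (OnBoard n) b →
    𝟙 (counted? b) ≡ weight n (λ f m → 𝟙 (f ≟ k) * 𝟙 (m ≟ 0)) b
  termwise b on = begin
    𝟙 (counted? b)
      ≡⟨ 𝟙-⇔ (counted? b) (rookPlacement? b ×-dec (numFree n b ≟ k ×-dec numMarked n b ≟ 0))
           (λ (max@(rp , _) , len) → rp , length⇒free rp len , maximal⇒unmarked n max)
           (λ (rp , free , m≡0) → unmarked⇒maximal n rp m≡0 , free⇒length rp free) ⟩
    𝟙 (rookPlacement? b ×-dec (numFree n b ≟ k ×-dec numMarked n b ≟ 0))
      ≡⟨ 𝟙-× (rookPlacement? b) (numFree n b ≟ k ×-dec numMarked n b ≟ 0) ⟩
    𝟙 (rookPlacement? b) * 𝟙 (numFree n b ≟ k ×-dec numMarked n b ≟ 0)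
      ≡⟨ cong (𝟙 (rookPlacement? b) *_) (𝟙-× (numFree n b ≟ k) (numMarked n b ≟ 0)) ⟩
    weight n (λ f m → 𝟙 (f ≟ k) * 𝟙 (m ≟ 0)) b ∎
    where
    length⇒free : RookPlacement b → length b ≡ n ∸ k → numFree n b ≡ k
    length⇒free rp len = +-cancelˡ-≡ (n ∸ k) _ _ (begin
      n ∸ k + numFree n b    ≡⟨ cong (_+ numFree n b) len ⟨
      length b + numFree n b ≡⟨ length+numFree n on rp ⟩
      n                      ≡⟨ m∸n+n≡m k≤n ⟨
      n ∸ k + k              ∎)
    free⇒length : RookPlacement b → numFree n b ≡ k → length b ≡ n ∸ k
    free⇒length rp refl = trans (sym (m+n∸n≡m (length b) (numFree n b)))
                                (cong (_∸ numFree n b) (length+numFree n on rp))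

corollary4p6 : ∀ (n k : ℕ) → 1 ≤ n → k ≤ n →
    F n (n ∸ k) ≡ k ! * ∑[ k ⋯ n ∸ k ] (λ i → S i k * S (n + 1 ∸ i) (k + 1))
corollary4p6 n k _ k≤n = begin
  F n (n ∸ k)
    ≡⟨ F-numWithState n k k≤n ⟩
  numWithState n k 0
    ≡⟨ numWithState-0 n k k≤n ⟩
  k ! * ∑[ k ⋯ n ∸ k ] (λ i → stirling i k * stirling (n + 1 ∸ i) (k + 1))
    ≡⟨ cong (k ! *_) (sumOver-cong (upTo (suc (n ∸ k) ∸ k)) λ d →
         cong₂ _*_ (S-stirling (k + d) k) (S-stirling (n + 1 ∸ (k + d)) (k + 1))) ⟨
  k ! * ∑[ k ⋯ n ∸ k ] (λ i → S i k * S (n + 1 ∸ i) (k + 1)) ∎
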